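{- In $\mathbf{MLM_{ext}}$, with $\mathrm{Acc}\,\gamma:=\mathrm{T}_{\mathbb{M}}(\mathrm{TI}^{\mathsf{tc}}\,g_{\mathrm{Acc}}\,\gamma)$, there are two terms $\mathsf{prog}$ and $\mathsf{E}_{\mathrm{Acc}}$ satisfying the following rules. (Introduction) If $\Gamma\vdash\alpha:\mathbb{V}$ and $\Gamma\vdash f:\Pi_{(x:\overline{\mathsf{tc}(\alpha)})}\mathrm{Acc}(\mathsf{pred}\,\mathsf{tc}(\alpha)\,x)$, then $\Gamma\vdash\mathsf{prog}\,f:\mathrm{Acc}\,\alpha$. (Elimination) If $\Gamma\vdash\alpha:\mathbb{V}$, $\Gamma\vdash t:\mathrm{Acc}\,\alpha$, $\Gamma,\beta:\mathbb{V},x:\mathrm{Acc}\,\beta\vdash C\;\mathrm{type}$ and $\Gamma\vdash g:\Pi_{(\gamma:\mathbb{V})}\Pi_{(f:\Pi_{(y:\overline{\mathsf{tc}(\gamma)})}\mathrm{Acc}(\mathsf{pred}\,\mathsf{tc}(\gamma)\,y))}((\Pi_{(y:\overline{\mathsf{tc}(\gamma)})}C[\mathsf{pred}\,\mathsf{tc}(\gamma)\,y/\beta,f\,y/x])\to C[\gamma/\beta,\mathsf{prog}\,f/x])$, then $\Gamma\vdash\mathsf{E}_{\mathrm{Acc}}\,\alpha\,t\,g:C[\alpha/\beta,t/x]$. (Computation) If $\Gamma\vdash\alpha:\mathbb{V}$, $\Gamma\vdash f:\Pi_{(y:\overline{\mathsf{tc}(\alpha)})}\mathrm{Acc}(\mathsf{pred}\,\mathsf{tc}(\alpha)\,y)$,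 and $C$, $g$ are as in the elimination rule, then $\Gamma\vdash\mathsf{E}_{\mathrm{Acc}}\,\alpha\,(\mathsf{prog}\,f)\,g=g\,\alpha\,f\,(\lambda y.\mathsf{E}_{\mathrm{Acc}}\,(\mathsf{pred}\,\mathsf{tc}(\alpha)\,y)\,(f\,y)\,g):C[\alpha/\beta,\mathsf{prog}\,f/x]$.
   Context: $\mathbf{MLM_{ext}}$ is Martin-Löf type theory ($\Pi$ with $\eta$-rule, $\Sigma,+,\mathrm{N},\mathrm{N}_n,\mathrm{W}$) with Setzer's Mahlo universe $\mathbb{M}$ (decoding $\mathrm{T}_{\mathbb{M}}$, closed under codes including $\widehat{\Pi}_{\mathbb{M}},\widehat{\Sigma}_{\mathbb{M}},\widehat{+}_{\mathbb{M}}$ with $\mathrm{T}_{\mathbb{M}}(\widehat{\Pi}_{\mathbb{M}}(a,b))=\Pi_{(x:\mathrm{T}_{\mathbb{M}}a)}\mathrm{T}_{\mathbb{M}}(b\,x)$ etc.), with extensional identity types: $\mathsf{r}:\mathrm{Id}(A,a,b)$ whenever $a=b:A$ judgementally, any $d:\mathrm{Id}(A,a,b)$ yields the judgement $a=b:A$, and $d=\mathsf{r}$. $\mathbb{V}:=\mathrm{W}_{(x:\mathbb{M})}\mathrm{T}_{\mathbb{M}}(x)$, $\mathsf{index}(\mathsf{sup}(a,f))=a$, $\mathsf{pred}(\mathsf{sup}(a,f))=f$, $\overline{\alpha}:=\mathrm{T}_{\mathbb{M}}(\mathsf{index}\,\alpha)$, $\forall\gamma\in\alpha\,G:=\Pi_{(x:\overline{\alpha})}G[\mathsf{pred}\,\alpha\,x/\gamma]$.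 $\bigcup\mathsf{sup}(a,f):=\mathsf{sup}(\widehat{\Sigma}_{\mathbb{M}}(a,\lambda x.\mathsf{index}(f\,x)),\lambda(x,y).\mathsf{pred}(f\,x)\,y)$, $\mathsf{sup}(a,f)\cup\mathsf{sup}(b,g):=\mathsf{sup}(a\,\widehat{+}_{\mathbb{M}}b,[f,g])$, $\mathsf{tc}(\mathsf{sup}(a,f)):=\mathsf{sup}(a,f)\cup\bigcup\mathsf{sup}(a,\lambda x.\mathsf{tc}(f\,x))$. For every type family $F$ over $\beta:\mathbb{V}$ there is a term $\mathrm{TI}^{\mathsf{tc}}:\Pi_{(\alpha:\mathbb{V})}(\forall\gamma\in\mathsf{tc}(\alpha)\,F[\gamma/\beta]\to F[\alpha/\beta])\to\Pi_{(\alpha:\mathbb{V})}F[\alpha/\beta]$ satisfying the judgemental computation rule $\mathrm{TI}^{\mathsf{tc}}\,g\,\alpha=g\,\alpha\,(\lambda x.\mathrm{TI}^{\mathsf{tc}}\,g\,(\mathsf{pred}\,\mathsf{tc}(\alpha)\,x))$. With $F:=\mathbb{M}$ and $g_{\mathrm{Acc}}:=\lambda\alpha.\lambda f.\widehat{\Pi}_{\mathbb{M}}(\mathsf{index}\,\mathsf{tc}(\alpha),\lambda x.f\,x)$, define $\mathrm{Acc}\,\gamma:=\mathrm{T}_{\mathbb{M}}(\mathrm{TI}^{\mathsf{tc}}\,g_{\mathrm{Acc}}\,\gamma)$. -}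

module Defs where

-- Model of the ambient theory MLM_ext inside Agda:
--  * the Mahlo universe 𝕄 with decoding T_𝕄 is rendered as Agda's universe
--    Set with decoding the identity, so that T_𝕄(Π̂ a b) = Π (x : T a) T (b x),
--    T_𝕄(Σ̂ a b) = Σ ..., T_𝕄(a +̂ b) = T a ⊎ T b hold judgementally;
--  * the extensional identity type of MLM_ext is rendered as Agda's _≡_
--    (with K, i.e. UIP, which Agda has by default).

open import Level using (Level; Setω)
open import Data.Product using (Σ; _,_)
open import Data.Sum using (_⊎_; [_,_])
open import Relation.Binary.PropositionalEquality using (_≡_)

𝕄 : Set₁
𝕄 = Set

T𝕄 : 𝕄 → Set
T𝕄 a = a

Π̂ : (a : 𝕄) → (T𝕄 a → 𝕄) → 𝕄
Π̂ a b = (x : T𝕄 a) → T𝕄 (b x)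

Σ̂ : (a : 𝕄) → (T𝕄 a → 𝕄) → 𝕄
Σ̂ a b = Σ (T𝕄 a) (λ x → T𝕄 (b x))

_+̂_ : 𝕄 → 𝕄 → 𝕄
a +̂ b = T𝕄 a ⊎ T𝕄 b

data W (A : Set₁) (B : A → Set) : Set₁ where
  sup : (a : A) → (B a → W A B) → W A B

𝕍 : Set₁
𝕍 = W 𝕄 T𝕄

index : 𝕍 → 𝕄
index (sup a f) = a

pred : (α : 𝕍) → T𝕄 (index α) → 𝕍
pred (sup a f) = f

‾_ : 𝕍 → Set
‾ α = T𝕄 (index α)

⋃ : 𝕍 → 𝕍
⋃ (sup a f) = sup (Σ̂ a (λ x → index (f x))) (λ { (x , y) → pred (f x) y })

_∪_ : 𝕍 → 𝕍 → 𝕍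
sup a f ∪ sup b g = sup (a +̂ b) [ f , g ]

tc : 𝕍 → 𝕍
tc (sup a f) = sup a f ∪ ⋃ (sup a (λ x → tc (f x)))

-- Transfinite induction along tc, for every type family F over 𝕍, with its
-- computation rule (given as a hypothesis, as in the paper's context).
record TItc : Setω where
  field
    TI : ∀ {ℓ : Level} (F : 𝕍 → Set ℓ)
       → ((α : 𝕍) → ((x : ‾ tc α) → F (pred (tc α) x)) → F α)
       → (α : 𝕍) → F α
    TI-comp : ∀ {ℓ : Level} (F : 𝕍 → Set ℓ)
       (g : (α : 𝕍) → ((x : ‾ tc α) → F (pred (tc α) x)) → F α)
       (α : 𝕍)
       → TI F g α ≡ g α (λ x → TI F g (pred (tc α) x))

gAcc : (α : 𝕍) → ((x : ‾ tc α) → 𝕄) → 𝕄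
gAcc α f = Π̂ (index (tc α)) (λ x → f x)

Acc : TItc → 𝕍 → Set
Acc I γ = T𝕄 (TItc.TI I (λ _ → 𝕄) gAcc γ)

record AccRules (I : TItc) : Setω where
  field
    prog : {α : 𝕍} → ((x : ‾ tc α) → Acc I (pred (tc α) x)) → Acc I α
    E-Acc : ∀ {ℓ : Level} (C : (β : 𝕍) → Acc I β → Set ℓ)
      (α : 𝕍) (t : Acc I α)
      (g : (γ : 𝕍) (f : (y : ‾ tc γ) → Acc I (pred (tc γ) y))
           → ((y : ‾ tc γ) → C (pred (tc γ) y) (f y))
           → C γ (prog f))
      → C α t
    E-Acc-comp : ∀ {ℓ : Level} (C : (β : 𝕍) → Acc I β → Set ℓ)
      (α : 𝕍) (f : (y : ‾ tc α) → Acc I (pred (tc α) y))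
      (g : (γ : 𝕍) (f : (y : ‾ tc γ) → Acc I (pred (tc γ) y))
           → ((y : ‾ tc γ) → C (pred (tc γ) y) (f y))
           → C γ (prog f))
      → E-Acc C α (prog f) g ≡ g α f (λ y → E-Acc C (pred (tc α) y) (f y) g)

-- By the computation rule of TI^tc, Acc α is identical to the type
-- Π (x : ‾ tc α) Acc (pred (tc α) x). So prog is transport along that
-- identity, every t : Acc α is prog of its own transport, and E_Acc is defined
-- by TI^tc with motive F β := Π (t : Acc β) C β t, splitting t as prog f. The
-- computation rule follows from that of TI^tc, since splitting prog f gives f.
module Submission where

open import Defs
open import Level using (Level)
open import Function using (id)
open import Relation.Binary.PropositionalEquality using (_≡_; refl; sym; trans; subst; cong-app)

cast⁻¹ : {A B : Set} → A ≡ B → B → A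
cast⁻¹ A≡B = subst id (sym A≡B)

cast⁻¹-elim : ∀ {ℓ} {A B : Set} (A≡B : A ≡ B) (P : A → Set ℓ) →
              ((b : B) → P (cast⁻¹ A≡B b)) → (a : A) → P a
cast⁻¹-elim refl P k = k

cast⁻¹-elim-β : ∀ {ℓ} {A B : Set} (A≡B : A ≡ B) (P : A → Set ℓ)
                (k : (b : B) → P (cast⁻¹ A≡B b)) (b : B) →
                cast⁻¹-elim A≡B P k (cast⁻¹ A≡B b) ≡ k b
cast⁻¹-elim-β refl P k b = refl

module _ (I : TItc) where
  open TItc I

  Acc-unfold : (α : 𝕍) → Acc I α ≡ ((x : ‾ tc α) → Acc I (pred (tc α) x))
  Acc-unfold = TI-comp (λ _ → 𝕄) gAcc

  prog : {α : 𝕍} → ((x : ‾ tc α) → Acc I (pred (tc α) x)) → Acc I α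
  prog {α} = cast⁻¹ (Acc-unfold α)

  module _ {ℓ : Level} (C : (β : 𝕍) → Acc I β → Set ℓ)
           (g : (γ : 𝕍) (f : (y : ‾ tc γ) → Acc I (pred (tc γ) y))
                → ((y : ‾ tc γ) → C (pred (tc γ) y) (f y))
                → C γ (prog f)) where

    step : (α : 𝕍) → ((x : ‾ tc α) → (t : Acc I (pred (tc α) x)) → C (pred (tc α) x) t) →
           (t : Acc I α) → C α t
    step α ih = cast⁻¹-elim (Acc-unfold α) (C α) (λ f → g α f (λ y → ih y (f y)))

    E-Acc : (α : 𝕍) (t : Acc I α) → C α t
    E-Acc = TI (λ β → (t : Acc I β) → C β t) step

    E-Acc-comp : (α : 𝕍) (f : (y : ‾ tc α) → Acc I (pred (tc α) y)) →
                 E-Acc α (prog f) ≡ g α f (λ y → E-Acc (pred (tc α) y) (f y))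
    E-Acc-comp α f = trans
      (cong-app (TI-comp (λ β → (t : Acc I β) → C β t) step α) (prog f))
      (cast⁻¹-elim-β (Acc-unfold α) (C α)
        (λ f′ → g α f′ (λ y → E-Acc (pred (tc α) y) (f′ y))) f)

propositionB4 : (I : TItc) → AccRules I
propositionB4 I = record
  { prog       = prog I
  ; E-Acc      = λ C α t g → E-Acc I C g α t
  ; E-Acc-comp = λ C α f g → E-Acc-comp I C g α f
  }
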